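{- Let $X$ be a graph and $\sim$ an equivalence relation on $V_X$. Assume that the quotient graph $X/\!\sim$ is connected and pseudo-covered by $X$ (with respect to $\sim$). If there exists an equivalence class $[x]$ ($x\in V_X$) such that $[x]\subseteq V_{C_X(x)}$, then $X$ is connected.
   Context: All graphs are finite, undirected, simple and reflexive: a graph $X=(V_X,E_X)$ has a finite nonempty vertex set $V_X$, and $E_X$ consists of all loops $\{x\}$ ($x\in V_X$; written $\{x,x\}$) together with a (possibly empty) set of $2$-element subsets of $V_X$. $C_X(x)$ denotes the component (maximal connected subgraph) of $X$ containing $x$, and $V_{C_X(x)}$ its vertex set. The quotient graph $X/\!\sim$ has as vertices the equivalence classes $[x]$, and $\{[x_1],[x_2]\}$ is an edge iff there are $\tilde x_1\sim x_1$, $\tilde x_2\sim x_2$ with $\{\tilde x_1,\tilde x_2\}\in E_X$. A homomorphism $\varphi:X\to Y$ is a map $V_X\to V_Y$ sending edges to edges (a proper edge may be mapped to a loop). It is locally strong if for all $x_1,x_2\in V_X$, $\{\varphi(x_1),\varphi(x_2)\}\in E_Y$ implies that for every $\tilde x_1\in\varphi^{ -1}(\varphi(x_1))$ there exists $\tilde x_2\in\varphi^{ -1}(\varphi(x_2))$ with $\{\tilde x_1,\tilde x_2\}\in E_X$. It is pseudo-covering if it is locally strong and surjective on vertices. $X/\!\sim$ is pseudo-covered by $X$ if the projection $\pi:X\to X/\!\sim$, $\pi(x)=[x]$, is pseudo-covering. -}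

module Defs where

open import Level using (Level; _⊔_) renaming (suc to lsuc)
open import Data.Fin.Base using (Fin)
open import Data.Product.Base using (Σ-syntax; ∃-syntax; _×_; _,_; proj₁; proj₂)
open import Function.Bundles using (Func)
open import Function.Definitions using (StrictlySurjective)
open import Relation.Binary.Bundles using (Setoid)
open import Relation.Binary.Core using (Rel; _⇒_)
open import Relation.Binary.Definitions using (Symmetric; _Respects_)
open import Relation.Binary.Structures using (IsEquivalence)
open import Relation.Binary.Construct.Closure.ReflexiveTransitive
  using (Star; ε; _◅_; _◅◅_; map)
open import Relation.Unary using (Pred; _∈_; _⊆_)

-- Vertices form a setoid so that equivalence classes can be the vertices of
-- a quotient graph.  The edge set is encoded by its adjacency relation:
-- `Edge x y` says that {x, y} is an edge.
-- `finite` lists the vertices up to ≈, possibly with repetitions; this is closed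
-- under quotients by equivalence relations that need not be decidable.
record Graph (c ℓ e : Level) : Set (lsuc (c ⊔ ℓ ⊔ e)) where
  field
    vertices : Setoid c ℓ
  open Setoid vertices public
    using (_≈_)
    renaming (Carrier to V; refl to ≈-refl; sym to ≈-sym; trans to ≈-trans)
  field
    Edge      : Rel V e
    edge-resp : ∀ {x x′ y y′} → x ≈ x′ → y ≈ y′ → Edge x y → Edge x′ y′
    loop      : ∀ x → Edge x x
    edge-sym  : Symmetric Edge
    finite    : ∃[ n ] Σ[ f ∈ (Fin n → V) ] StrictlySurjective _≈_ f
    nonempty  : V

private
  variable
    c ℓ e c′ ℓ′ e′ r : Level

-- `Star Edge x y` is the type of walks from x to y.
Connected : Graph c ℓ e → Set (c ⊔ e)
Connected X = ∀ x y → Star Edge x y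
  where open Graph X

-- Subgraphs are again reflexive.  Finiteness is not
-- required separately: classically it is inherited from X, while listing an
-- undecidable subset is not possible constructively.
record Subgraph {c ℓ e} (X : Graph c ℓ e) : Set (lsuc (c ⊔ e) ⊔ ℓ) where
  open Graph X
  field
    Vₛ         : Pred V (c ⊔ e)
    Vₛ-resp    : Vₛ Respects _≈_
    Edgeₛ      : Rel V (c ⊔ e)
    Edgeₛ-resp : ∀ {x x′ y y′} → x ≈ x′ → y ≈ y′ → Edgeₛ x y → Edgeₛ x′ y′
    Edgeₛ-sym  : Symmetric Edgeₛ
    Edgeₛ-loop : ∀ {x} → x ∈ Vₛ → Edgeₛ x x
    Edgeₛ-ends : ∀ {x y} → Edgeₛ x y → x ∈ Vₛ × y ∈ Vₛ
    Edgeₛ⇒Edge : Edgeₛ ⇒ Edge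

module _ {X : Graph c ℓ e} where
  open Subgraph

  infix 4 _⊑_

  _⊑_ : Subgraph X → Subgraph X → Set (c ⊔ e)
  H ⊑ K = (Vₛ H ⊆ Vₛ K) × (Edgeₛ H ⇒ Edgeₛ K)

  Connectedₛ : Subgraph X → Set (c ⊔ e)
  Connectedₛ H = ∀ {x y} → x ∈ Vₛ H → y ∈ Vₛ H → Star (Edgeₛ H) x y

record Component {c ℓ e} (X : Graph c ℓ e) (x : Graph.V X) :
                 Set (lsuc (c ⊔ e) ⊔ ℓ) where
  field
    subgraph  : Subgraph X
  open Subgraph subgraph public
  field
    contains  : x ∈ Vₛ
    connected : Connectedₛ subgraph
    maximal   : ∀ H → Connectedₛ H → subgraph ⊑ H → H ⊑ subgraph

-- The component of x exists: its vertices are those reachable from x.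
C : (X : Graph c ℓ e) (x : Graph.V X) → Component X x
C X x = record
  { subgraph  = record
    { Vₛ         = Star Edge x
    ; Vₛ-resp    = λ y≈y′ w → w ◅◅ (edge-resp ≈-refl y≈y′ (loop _) ◅ ε)
    ; Edgeₛ      = λ y z → Star Edge x y × Edge y z
    ; Edgeₛ-resp = λ y≈y′ z≈z′ (w , yz) →
                     w ◅◅ (edge-resp ≈-refl y≈y′ (loop _) ◅ ε)
                     , edge-resp y≈y′ z≈z′ yz
    ; Edgeₛ-sym  = λ (w , yz) → w ◅◅ (yz ◅ ε) , edge-sym yz
    ; Edgeₛ-loop = λ w → w , loop _
    ; Edgeₛ-ends = λ (w , yz) → w , w ◅◅ (yz ◅ ε)
    ; Edgeₛ⇒Edge = proj₂
    }
  ; contains  = ε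
  ; connected = λ w w′ → within w (reverse w ◅◅ w′)
  ; maximal   = λ H H-conn (C⊆H , _) →
      let open Subgraph H
          reach : Vₛ ⊆ Star Edge x
          reach y∈H = map Edgeₛ⇒Edge (H-conn (C⊆H ε) y∈H)
      in reach , λ yz → reach (proj₁ (Edgeₛ-ends yz)) , Edgeₛ⇒Edge yz
  }
  where
  open Graph X

  reverse : ∀ {y z} → Star Edge y z → Star Edge z y
  reverse ε        = ε
  reverse (s ◅ ss) = reverse ss ◅◅ (edge-sym s ◅ ε)

  within : ∀ {y z} → Star Edge x y → Star Edge y z →
           Star (λ u v → Star Edge x u × Edge u v) y z
  within w ε        = ε
  within w (s ◅ ss) = (w , s) ◅ within (w ◅◅ (s ◅ ε)) ss

record Homomorphism {c ℓ e c′ ℓ′ e′} (X : Graph c ℓ e) (Y : Graph c′ ℓ′ e′) :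
                    Set (c ⊔ ℓ ⊔ e ⊔ c′ ⊔ ℓ′ ⊔ e′) where
  private
    module X = Graph X
    module Y = Graph Y
  field
    func     : Func X.vertices Y.vertices
  open Func func public using (to; cong)
  field
    preserve : ∀ {x y} → X.Edge x y → Y.Edge (to x) (to y)

module _ {X : Graph c ℓ e} {Y : Graph c′ ℓ′ e′} (φ : Homomorphism X Y) where
  private
    module X = Graph X
    module Y = Graph Y
  open Homomorphism φ

  Fibre : Y.V → Pred X.V ℓ′
  Fibre y x = to x Y.≈ y

  LocallyStrong : Set (c ⊔ e ⊔ ℓ′ ⊔ e′)
  LocallyStrong =
    ∀ x₁ x₂ → Y.Edge (to x₁) (to x₂) →
    ∀ x̃₁ → x̃₁ ∈ Fibre (to x₁) →
    ∃[ x̃₂ ] (x̃₂ ∈ Fibre (to x₂) × X.Edge x̃₁ x̃₂)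

  PseudoCovering : Set (c ⊔ e ⊔ c′ ⊔ ℓ′ ⊔ e′)
  PseudoCovering = LocallyStrong × StrictlySurjective Y._≈_ to

-- `≈⇒∼` makes ∼ well defined on the vertices of X, as opposed to their names.
record VertexEquivalence {c ℓ e} (X : Graph c ℓ e) (r : Level) :
                         Set (c ⊔ ℓ ⊔ lsuc r) where
  open Graph X using (V; _≈_)
  infix 4 _∼_
  field
    _∼_           : Rel V r
    ∼-equivalence : IsEquivalence _∼_
    ≈⇒∼           : _≈_ ⇒ _∼_
  open IsEquivalence ∼-equivalence public
    using () renaming (refl to ∼-refl; sym to ∼-sym; trans to ∼-trans)

  [_] : V → Pred V r
  [ x ] y = y ∼ x

module _ (X : Graph c ℓ e) (R : VertexEquivalence X r) where
  open Graph X
  open VertexEquivalence R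

  -- A vertex of the quotient is a class, named by any of its members.
  infixl 7 _/_
  _/_ : Graph c r (c ⊔ e ⊔ r)
  _/_ = record
    { vertices  = record { isEquivalence = ∼-equivalence }
    ; Edge      = λ x₁ x₂ → ∃[ x̃₁ ] ∃[ x̃₂ ] (x̃₁ ∼ x₁ × x̃₂ ∼ x₂ × Edge x̃₁ x̃₂)
    ; edge-resp = λ x∼x′ y∼y′ (x̃ , ỹ , p , q , xy) →
                    x̃ , ỹ , ∼-trans p x∼x′ , ∼-trans q y∼y′ , xy
    ; loop      = λ x → x , x , ∼-refl , ∼-refl , loop x
    ; edge-sym  = λ (x̃ , ỹ , p , q , xy) → ỹ , x̃ , q , p , edge-sym xy
    ; finite    = let (n , f , surj) = finite in
                  n , f , λ y → let (i , fi≈y) = surj y in i , ≈⇒∼ fi≈y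
    ; nonempty  = nonempty
    }

  π : Homomorphism X _/_
  π = record
    { func     = record { to = λ x → x ; cong = ≈⇒∼ }
    ; preserve = λ {x} {y} xy → x , y , ∼-refl , ∼-refl , xy
    }

  PseudoCovered : Set (c ⊔ e ⊔ r)
  PseudoCovered = PseudoCovering π

{-# OPTIONS --safe #-}
module Submission where

open import Defs
open import Level using (Level)
open import Data.Product.Base using (∃-syntax; _×_; _,_)
open import Relation.Binary.Construct.Closure.ReflexiveTransitive
  using (Star; ε; _◅_; _◅◅_; reverse)
open import Relation.Unary using (_∈_; _⊆_)

-- Walks lift along a pseudo-covering from any starting point in the fibre.
-- So a walk in X/∼ from [u] to [x] lifts to a walk in X from u into the class
-- [x], which lies in the component of x; hence every u is joined to x.

private
  variable
    c ℓ e c′ ℓ′ e′ : Level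

module _ {X : Graph c ℓ e} {Y : Graph c′ ℓ′ e′} (φ : Homomorphism X Y)
         (φ-pseudoCovering : PseudoCovering φ) where
  private
    module X = Graph X
    module Y = Graph Y

  -- By induction on the walk: local strongness lifts the first edge to one starting at the given
  -- `x`, and its far end again lies over the next vertex.
  lift-walk : ∀ {y y′ x} → Star Y.Edge y y′ → x ∈ Fibre φ y →
              ∃[ x′ ] (x′ ∈ Fibre φ y′ × Star X.Edge x x′)
  lift-walk {x = x} ε x∈y = x , x∈y , ε
  lift-walk {x = x} (_◅_ {j = z} yz w) x∈y =
    let locallyStrong , surjective = φ-pseudoCovering
        -- Local strongness speaks only of edges between images, so `z` is first replaced by the
        -- image of some `z₀`.
        z₀ , z₀∈z         = surjective z
        x₁ , x₁∈z₀ , x-x₁ = locallyStrong x z₀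
                              (Y.edge-resp (Y.≈-sym x∈y) (Y.≈-sym z₀∈z) yz)
                              x Y.≈-refl
        x′ , x′∈y′ , w̃    = lift-walk w (Y.≈-trans x₁∈z₀ z₀∈z)
    in x′ , x′∈y′ , x-x₁ ◅ w̃

corollary5p15 : {c ℓ e r : Level} (X : Graph c ℓ e) (R : VertexEquivalence X r) →
    let open VertexEquivalence R using ([_]) in
    Connected (X / R) →
    PseudoCovered X R →
    (∃[ x ] ([ x ] ⊆ Component.Vₛ (C X x))) →
    Connected X
corollary5p15 X R X/R-connected π-pseudoCovering (x , [x]⊆C) u v =
  reverse edge-sym (from-x u) ◅◅ from-x v
  where
  open Graph X
  open VertexEquivalence R

  from-x : ∀ u → Star Edge x u
  from-x u =
    let x′ , x′∼x , w = lift-walk (π X R) π-pseudoCovering (X/R-connected u x) ∼-refl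
    -- Membership in the component `C X x` is by construction a walk from `x`, so `[x]⊆C` yields one
    -- to `x′`.
    in [x]⊆C x′∼x ◅◅ reverse edge-sym w
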